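{- Let $\mathcal{C}$ be a Ramsey class of $\mathcal{L}'$-structures and $\mathcal{N}$ an $\mathcal{L}'$-structure such that $\mathrm{Age}(\mathcal{N})=\mathcal{C}$. Then there is an $\mathrm{Aut}(\mathcal{N})$-invariant linear order on $\mathcal{N}$ which is a union of quantifier-free types. More explicitly, there is a (possibly infinite) Boolean combination of atomic and negated atomic $\mathcal{L}'$-formulas $\Phi(x,y):=\bigvee_{i\in I}\bigwedge_{j\in J_i}\varphi_{i,j}(x,y)$, with each $\varphi_{i,j}$ an atomic or negated atomic $\mathcal{L}'$-formula (the index sets $I,J_i$ being arbitrary, possibly infinite), such that $\Phi$ defines a linear order on every structure in $\mathcal{C}$.
   Context: $\mathcal{L}'$ is a first-order language. $\mathrm{Age}(\mathcal{N})$ is the class of (isomorphism types of) finitely generated substructures of $\mathcal{N}$; it is treated as an isomorphism-closed class. For structures $A,C$, $\binom{C}{A}$ is the set of embeddings $A\to C$. For $A\subseteq B$, write $C\to(B)^A_2$ if for every colouring $\chi:\binom{C}{A}\to\{0,1\}$ there is an embedding $e:B\to C$ such that $\chi$ is constant on $\{e\circ f: f\in\binom{B}{A}\}$. A class $\mathcal{C}$ has HP if it is closed under substructures; JEP if any two members embed in a common member; ERP if for all $A\subseteq B$ in $\mathcal{C}$ there is $C\in\mathcal{C}$ with $C\to(B)^A_2$. A Ramsey class is an isomorphism-closed class of finite structures with HP, JEP and ERP. A binary relation on $\mathcal{N}$ is a union of quantifier-free types if it is a union of sets of realisations in $\mathcal{N}$ of complete quantifier-free types (over $\emptyset$) in two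 variables. -}

module Defs where

open import Level using (Level; _⊔_; suc)
open import Data.Nat.Base using (ℕ)
open import Data.Fin.Base using (Fin)
open import Data.Product.Base using (Σ-syntax; ∃-syntax; _×_; _,_; proj₁; proj₂)
open import Data.Sum.Base using (_⊎_)
open import Data.Vec.Functional using (Vector; []; _∷_)
open import Function.Base using (_∘_)
open import Function.Bundles using (Func; Injection; Inverse; _⇔_)
open import Function.Definitions using (Surjective)
import Function.Construct.Composition as Comp
import Relation.Binary.Construct.On as On
open import Relation.Binary.Bundles using (Setoid)
open import Relation.Binary.Core using (Rel)
open import Relation.Binary.Structures using (IsTotalOrder)
open import Relation.Binary.PropositionalEquality as ≡ using (_≡_)
open import Relation.Nullary using (¬_)
open import Relation.Unary using (Pred; _∈_)

private
  variable
    ℓ κ : Level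

record Language (ℓ : Level) : Set (suc ℓ) where
  field
    FunSym : Set ℓ
    RelSym : Set ℓ
    arityᶠ : FunSym → ℕ
    arityʳ : RelSym → ℕ

-- The underlying set is a setoid, so that a subset given by a predicate
-- (a substructure) again underlies a structure.  It may be empty.
record Structure (L : Language ℓ) : Set (suc ℓ) where
  open Language L
  field
    setoid : Setoid ℓ ℓ
  open Setoid setoid public using (Carrier; _≈_)
  field
    fun      : (f : FunSym) → Vector Carrier (arityᶠ f) → Carrier
    fun-cong : ∀ f {xs ys} → (∀ i → xs i ≈ ys i) → fun f xs ≈ fun f ys
    rel      : (R : RelSym) → Vector Carrier (arityʳ R) → Set ℓ
    rel-resp : ∀ R {xs ys} → (∀ i → xs i ≈ ys i) → rel R xs → rel R ys

module _ {L : Language ℓ} where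

  open Language L
  private
    ∣_∣ : Structure L → Set ℓ
    ∣_∣ = Structure.Carrier

  record Embedding (A B : Structure L) : Set ℓ where
    private
      module A = Structure A
      module B = Structure B
    field
      injection : Injection A.setoid B.setoid
    open Injection injection public using (to; cong; injective)
    field
      fun-homo : ∀ f xs → to (A.fun f xs) B.≈ B.fun f (to ∘ xs)
      rel-iff  : ∀ R xs → A.rel R xs ⇔ B.rel R (to ∘ xs)

  infixr 9 _∘ᴱ_

  _∘ᴱ_ : {A B C : Structure L} → Embedding B C → Embedding A B → Embedding A C
  _∘ᴱ_ {C = C} g f = record
    { injection = Comp.injection f.injection g.injection
    ; fun-homo  = λ s xs → Setoid.trans (Structure.setoid C)
                    (g.cong (f.fun-homo s xs)) (g.fun-homo s (f.to ∘ xs))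
    ; rel-iff   = λ R xs → Comp.equivalence (f.rel-iff R xs) (g.rel-iff R (f.to ∘ xs))
    }
    where
      module f = Embedding f
      module g = Embedding g

  record Isomorphism (A B : Structure L) : Set ℓ where
    private
      module A = Structure A
      module B = Structure B
    field
      embedding : Embedding A B
    open Embedding embedding public
    field
      surjective : Surjective A._≈_ B._≈_ to

  Automorphism : Structure L → Set ℓ
  Automorphism N = Isomorphism N N

  IsFinite : Structure L → Set ℓ
  IsFinite A = ∃[ n ] Inverse (≡.setoid (Fin n)) (Structure.setoid A)

  record Substructure (B : Structure L) : Set (suc ℓ) where
    open Structure B
    field
      member     : Pred Carrier ℓ
      resp       : ∀ {x y} → x ≈ y → x ∈ member → y ∈ member
      fun-closed : ∀ f xs → (∀ i → xs i ∈ member) → fun f xs ∈ member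

  induced : {B : Structure L} → Substructure B → Structure L
  induced {B} S = record
    { setoid   = On.setoid setoid (proj₁ {B = member})
    ; fun      = λ f xs → fun f (proj₁ ∘ xs) , fun-closed f (proj₁ ∘ xs) (proj₂ ∘ xs)
    ; fun-cong = λ f xs≈ys → fun-cong f xs≈ys
    ; rel      = λ R xs → rel R (proj₁ ∘ xs)
    ; rel-resp = λ R xs≈ys → rel-resp R xs≈ys
    }
    where
      open Structure B
      open Substructure S

  data Generated (B : Structure L) {n : ℕ} (gs : Vector ∣ B ∣ n) : Pred ∣ B ∣ ℓ where
    gen  : ∀ i → Generated B gs (gs i)
    app  : ∀ f xs → (∀ i → Generated B gs (xs i)) → Generated B gs (Structure.fun B f xs)
    resp : ∀ {x y} → Structure._≈_ B x y → Generated B gs x → Generated B gs y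

  ⟨_⟩ : {B : Structure L} {n : ℕ} → Vector ∣ B ∣ n → Substructure B
  ⟨_⟩ {B = B} gs = record { member = Generated B gs ; resp = resp ; fun-closed = app }

  Age : Structure L → Pred (Structure L) ℓ
  Age N A = ∃[ n ] Σ[ gs ∈ Vector ∣ N ∣ n ] Isomorphism A (induced (⟨_⟩ {B = N} gs))

  -- Embeddings are equal when they agree pointwise; colourings are functions
  -- on this setoid, i.e. on embeddings as maps.
  embeddings : Structure L → Structure L → Setoid ℓ ℓ
  embeddings A C = record
    { Carrier       = Embedding A C
    ; _≈_           = λ f g → ∀ x → Embedding.to f x C.≈ Embedding.to g x
    ; isEquivalence = record
      { refl  = λ _ → C.refl
      ; sym   = λ p x → C.sym (p x)
      ; trans = λ p q x → C.trans (p x) (q x)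
      }
    }
    where module C = Setoid (Structure.setoid C)

  Colouring : Structure L → Structure L → Set ℓ
  Colouring A C = Func (embeddings A C) (≡.setoid (Fin 2))

  infix 4 _⟶⟨_⟩^_

  _⟶⟨_⟩^_ : (C B A : Structure L) → Set ℓ
  C ⟶⟨ B ⟩^ A = (χ : Colouring A C) →
    Σ[ e ∈ Embedding B C ] ∀ (f g : Embedding A B) → Func.to χ (e ∘ᴱ f) ≡ Func.to χ (e ∘ᴱ g)

  HP : Pred (Structure L) κ → Set (suc ℓ ⊔ κ)
  HP 𝒞 = ∀ {B} → B ∈ 𝒞 → (S : Substructure B) → induced S ∈ 𝒞

  JEP : Pred (Structure L) κ → Set (suc ℓ ⊔ κ)
  JEP 𝒞 = ∀ {A B} → A ∈ 𝒞 → B ∈ 𝒞 → ∃[ C ] C ∈ 𝒞 × Embedding A C × Embedding B C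

  ERP : Pred (Structure L) κ → Set (suc ℓ ⊔ κ)
  ERP 𝒞 = ∀ {B} → B ∈ 𝒞 → (A : Substructure B) → induced A ∈ 𝒞 →
    ∃[ C ] C ∈ 𝒞 × (C ⟶⟨ B ⟩^ induced A)

  record IsRamseyClass (𝒞 : Pred (Structure L) κ) : Set (suc ℓ ⊔ κ) where
    field
      iso-closed : ∀ {A B} → Isomorphism A B → A ∈ 𝒞 → B ∈ 𝒞
      finite     : ∀ {A} → A ∈ 𝒞 → IsFinite A
      hp         : HP 𝒞
      jep        : JEP 𝒞
      erp        : ERP 𝒞

module _ (L : Language ℓ) where

  open Language L

  data Term (n : ℕ) : Set ℓ where
    var : Fin n → Term n
    app : (f : FunSym) → Vector (Term n) (arityᶠ f) → Term n

  data Atomic (n : ℕ) : Set ℓ where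
    _≈′_ : Term n → Term n → Atomic n
    rel′ : (R : RelSym) → Vector (Term n) (arityʳ R) → Atomic n

  data Literal (n : ℕ) : Set ℓ where
    pos neg : Atomic n → Literal n

  data QF (n : ℕ) : Set ℓ where
    atom      : Atomic n → QF n
    ¬′_       : QF n → QF n
    _∧′_ _∨′_ : QF n → QF n → QF n

  -- ⋁_{i ∈ I} ⋀_{j ∈ J i} φ i j, with arbitrary index sets.
  record InfDNF (n : ℕ) : Set (suc ℓ) where
    field
      I : Set ℓ
      J : I → Set ℓ
      φ : (i : I) → J i → Literal n

module Semantics {L : Language ℓ} (M : Structure L) where

  open Structure M

  ⟦_⟧ᵗ : ∀ {n} → Term L n → Vector Carrier n → Carrier
  ⟦ var i ⟧ᵗ    ρ = ρ i
  ⟦ app f ts ⟧ᵗ ρ = fun f (λ i → ⟦ ts i ⟧ᵗ ρ)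

  ⟦_⟧ᵃ : ∀ {n} → Atomic L n → Vector Carrier n → Set ℓ
  ⟦ s ≈′ t ⟧ᵃ    ρ = ⟦ s ⟧ᵗ ρ ≈ ⟦ t ⟧ᵗ ρ
  ⟦ rel′ R ts ⟧ᵃ ρ = rel R (λ i → ⟦ ts i ⟧ᵗ ρ)

  ⟦_⟧ˡ : ∀ {n} → Literal L n → Vector Carrier n → Set ℓ
  ⟦ pos α ⟧ˡ ρ = ⟦ α ⟧ᵃ ρ
  ⟦ neg α ⟧ˡ ρ = ¬ ⟦ α ⟧ᵃ ρ

  ⟦_⟧ : ∀ {n} → QF L n → Vector Carrier n → Set ℓ
  ⟦ atom α ⟧  ρ = ⟦ α ⟧ᵃ ρ
  ⟦ ¬′ φ ⟧    ρ = ¬ ⟦ φ ⟧ ρ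
  ⟦ φ ∧′ ψ ⟧  ρ = ⟦ φ ⟧ ρ × ⟦ ψ ⟧ ρ
  ⟦ φ ∨′ ψ ⟧  ρ = ⟦ φ ⟧ ρ ⊎ ⟦ ψ ⟧ ρ

  ⟦_⟧^∞ : ∀ {n} → InfDNF L n → Vector Carrier n → Set ℓ
  ⟦ Φ ⟧^∞ ρ = Σ[ i ∈ I ] ∀ (j : J i) → ⟦ φ i j ⟧ˡ ρ
    where open InfDNF Φ

  definedRel : InfDNF L 2 → Rel Carrier ℓ
  definedRel Φ x y = ⟦ Φ ⟧^∞ (x ∷ y ∷ [])

  Satisfies : ∀ {n} → Pred (QF L n) ℓ → Vector Carrier n → Set ℓ
  Satisfies p ρ = ∀ φ → φ ∈ p → ⟦ φ ⟧ ρ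

open Semantics public using (definedRel; Satisfies)

record CompleteQFType (L : Language ℓ) (n : ℕ) : Set (suc ℓ) where
  field
    formulas    : Pred (QF L n) ℓ
    satisfiable : Σ[ M ∈ Structure L ] ∃[ ρ ] Satisfies M formulas ρ
    complete    : ∀ φ → φ ∈ formulas ⊎ (¬′ φ) ∈ formulas

module _ {L : Language ℓ} (N : Structure L) where

  open Structure N

  IsLinearOrder : Rel Carrier ℓ → Set ℓ
  IsLinearOrder = IsTotalOrder _≈_

  IsAutInvariant : Rel Carrier ℓ → Set ℓ
  IsAutInvariant _≤_ = ∀ (σ : Automorphism N) x y → (x ≤ y) ⇔ (to σ x ≤ to σ y)
    where open Isomorphism

  IsUnionOfQFTypes : Rel Carrier ℓ → Set (suc ℓ)
  IsUnionOfQFTypes _≤_ = Σ[ K ∈ Set ℓ ] Σ[ p ∈ (K → CompleteQFType L 2) ]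
    ∀ x y → (x ≤ y) ⇔ (∃[ k ] Satisfies N (CompleteQFType.formulas (p k)) (x ∷ y ∷ []))

{-# OPTIONS --safe #-}

-- If B is in the class, apply ERP once for each of the finitely many pairs of B, with the
-- substructure generated by the pair: this gives C in the class such that, for every
-- colouring of the pairs of C, some embedding e : B → C makes the colour of (e x , e y)
-- depend only on the quantifier-free type of (x , y).  Colouring by a linear order of the
-- finite set C and pulling it back along e gives a linear order on B decided by a set of
-- quantifier-free types.  By JEP such sets can be found for finitely many members
-- simultaneously, and each member only involves finitely many types, so compactness of
-- 2^T, for T the set of types, yields one set of types that orders all members.  It also
-- orders N, because being a linear order is a condition on the substructures generated by
-- three elements.
module Submission where

open import Axiom.ExcludedMiddle using (ExcludedMiddle)
open import Axiom.Extensionality.Propositional using (Extensionality)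
open import Level using (Level; _⊔_)
open import Data.Bool.Base using (Bool; true; false; if_then_else_)
open import Data.Fin.Base using (zero; suc)
open import Data.Fin.Properties using (2↔Bool; ≤-isTotalOrder; _≤?_)
open import Data.List.Base using (List; []; _∷_; _++_; map; allFin; cartesianProduct)
open import Data.List.Membership.Propositional using () renaming (_∈_ to _∈ˡ_)
open import Data.List.Membership.Propositional.Properties using (∈-allFin; ∈-map⁺; ∈-cartesianProduct⁺)
open import Data.List.Relation.Binary.Subset.Propositional using () renaming (_⊆_ to _⊆ˡ_)
open import Data.List.Relation.Binary.Subset.Propositional.Properties
  using (All-resp-⊇; ∷⁺ʳ; xs⊆x∷xs)
open import Data.List.Relation.Unary.All as All using (All; []; _∷_)
import Data.List.Relation.Unary.All.Properties as Allₚ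
open import Data.List.Relation.Unary.Any using (here; there)
open import Data.Product.Base using (∃; Σ-syntax; ∃-syntax; _×_; _,_; proj₁; proj₂)
open import Data.Sum.Base as Sum using (_⊎_; inj₁; inj₂)
open import Data.Vec.Functional using (Vector) renaming ([] to []ᵛ; _∷_ to infixr 5 _∷ᵛ_)
open import Function.Base using (_∘_; id)
open import Function.Bundles using (Func; Inverse; Equivalence; _⇔_; mk⇔)
open import Function.Construct.Identity using (⇔-id)
open import Relation.Binary.Bundles using (Setoid)
open import Relation.Binary.Core using (Rel)
import Relation.Binary.Morphism.OrderMonomorphism as OrderMonomorphism
open import Relation.Binary.Structures using (IsTotalOrder)
open import Relation.Binary.PropositionalEquality using (_≡_; refl; sym; trans; cong; cong₂; subst)
open import Relation.Nullary using (¬_; Dec; does; yes; no; contradiction)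
open import Relation.Nullary.Decidable using (toSum; does-⇔; dec-true; dec-false; decidable-stable)
open import Relation.Unary using (Pred; _∈_; _≐_)
open import Defs

does⁻ : ∀ {p} {P : Set p} (d : Dec P) → does d ≡ true → P
does⁻ (yes p) _ = p

-- Compactness of 2^T

module Classical (em : ∀ {a} → ExcludedMiddle a) (ext : ∀ {a b} → Extensionality a b) where

  private
    variable
      a b c : Level
      X : Set a

  decide : Set a → Bool
  decide P = does (em {P = P})

  decide⁺ : {P : Set a} → P → decide P ≡ true
  decide⁺ = dec-true em

  decide⁻ : {P : Set a} → decide P ≡ true → P
  decide⁻ = does⁻ em

  byContradiction : {P : Set a} → ¬ ¬ P → P
  byContradiction = decidable-stable em

  ¬∀⇒∃¬ : {P : X → Set b} → ¬ (∀ x → P x) → ∃ λ x → ¬ P x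
  ¬∀⇒∃¬ ¬∀ = byContradiction λ ¬∃ → ¬∀ λ x → byContradiction λ ¬p → ¬∃ (x , ¬p)

  -- Bool-valued, so that a family of subsets of X, and the union of such a
  -- family, live at the universe level of X.
  Subset : Set a → Set a
  Subset X = X → Bool

  infix 4 _∈ˢ_ _⊆_

  _∈ˢ_ : X → Subset X → Set
  x ∈ˢ S = S x ≡ true

  _⊆_ : Subset X → Subset X → Set _
  S ⊆ S′ = ∀ {x} → x ∈ˢ S → x ∈ˢ S′

  ⊆-antisym : (S S′ : Subset X) → S ⊆ S′ → S′ ⊆ S → S ≡ S′
  ⊆-antisym S S′ p q = ext λ x → agree (S x) (S′ x) p q
    where
    agree : ∀ s s′ → (s ≡ true → s′ ≡ true) → (s′ ≡ true → s ≡ true) → s ≡ s′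
    agree true  s′    p q = sym (p refl)
    agree false true  p q = q refl
    agree false false p q = refl

  ⋃ : Subset (Subset X) → Subset X
  ⋃ 𝒰 x = decide (∃[ S ] S ∈ˢ 𝒰 × x ∈ˢ S)

  ⋃-upper : {𝒰 : Subset (Subset X)} {S : Subset X} → S ∈ˢ 𝒰 → S ⊆ ⋃ 𝒰
  ⋃-upper S∈𝒰 x∈S = decide⁺ (_ , S∈𝒰 , x∈S)

  ⋃-least : {𝒰 : Subset (Subset X)} {S : Subset X} → (∀ {U} → U ∈ˢ 𝒰 → U ⊆ S) → ⋃ 𝒰 ⊆ S
  ⋃-least 𝒰⊆S x∈⋃ with _ , U∈𝒰 , x∈U ← decide⁻ x∈⋃ = 𝒰⊆S U∈𝒰 x∈U

  insert : X → Subset X → Subset X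
  insert x S y = decide (y ≡ x ⊎ y ∈ˢ S)

  -- Towers of subsets and a fixed point of an inflationary map (Bourbaki-Witt).

  module BourbakiWitt {X : Set a} (next : Subset X → Subset X) (⊆-next : ∀ S → S ⊆ next S) where

    -- The least family closed under `next` and arbitrary unions. The empty set enters as the union
    -- of the empty family, so no base case appears.
    data Tower : Subset X → Set a where
      step  : ∀ {S} → Tower S → Tower (next S)
      union : ∀ 𝒰 → (∀ {S} → S ∈ˢ 𝒰 → Tower S) → Tower (⋃ 𝒰)

    -- The extreme points of the Bourbaki-Witt argument: no member of the tower strictly below `C`
    -- is carried beyond `C` by `next`. Strictness is replaced by the alternative `C ⊆ S`.
    Extreme : Subset X → Set a
    Extreme C = ∀ {S} → Tower S → S ⊆ C → next S ⊆ C ⊎ C ⊆ S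

    -- Induction on the tower. A union either has all its members inside `C`, or has a member not
    -- inside `C`, which by induction contains `next C`.
    extreme-comparable : ∀ {C} → Extreme C → ∀ {S} → Tower S → S ⊆ C ⊎ next C ⊆ S
    extreme-comparable {C} extreme (step {S} tS) with extreme-comparable extreme tS
    ... | inj₂ nC⊆S = inj₂ (⊆-next S ∘ nC⊆S)
    ... | inj₁ S⊆C with extreme tS S⊆C
    ...   | inj₁ nS⊆C = inj₁ nS⊆C
    ...   | inj₂ C⊆S with refl ← ⊆-antisym S C S⊆C C⊆S = inj₂ id
    extreme-comparable {C} extreme (union 𝒰 t) with em {P = ∀ {U} → U ∈ˢ 𝒰 → U ⊆ C}
    ... | yes 𝒰⊆C = inj₁ (⋃-least {𝒰 = 𝒰} 𝒰⊆C)
    ... | no ¬𝒰⊆C = inj₂ (byContradiction λ nC⊈⋃ → ¬𝒰⊆C λ {U} U∈𝒰 → below nC⊈⋃ U U∈𝒰)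
      where
      below : ¬ (next C ⊆ ⋃ 𝒰) → ∀ U → U ∈ˢ 𝒰 → U ⊆ C
      below nC⊈⋃ U U∈𝒰 with extreme-comparable extreme (t U∈𝒰)
      ... | inj₁ U⊆C  = U⊆C
      ... | inj₂ nC⊆U = contradiction (λ {x} → ⋃-upper {𝒰 = 𝒰} U∈𝒰 ∘ nC⊆U {x}) nC⊈⋃

    tower-extreme : ∀ {C} → Tower C → Extreme C
    tower-extreme (step {C} tC) {S} tS S⊆nC with extreme-comparable (tower-extreme tC) tS
    ... | inj₂ nC⊆S = inj₂ nC⊆S
    ... | inj₁ S⊆C with tower-extreme tC tS S⊆C
    ...   | inj₁ nS⊆C = inj₁ (⊆-next C ∘ nS⊆C)
    ...   | inj₂ C⊆S with refl ← ⊆-antisym S C S⊆C C⊆S = inj₁ id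
    tower-extreme (union 𝒰 t) {S} tS S⊆⋃ with em {P = ∃[ U ] U ∈ˢ 𝒰 × S ⊆ U}
    ... | no ¬∃ = inj₂ (⋃-least {𝒰 = 𝒰} λ {U} U∈𝒰 → above U U∈𝒰)
      where
      above : ∀ U → U ∈ˢ 𝒰 → U ⊆ S
      above U U∈𝒰 with extreme-comparable (tower-extreme (t U∈𝒰)) tS
      ... | inj₁ S⊆U  = contradiction (U , U∈𝒰 , λ {x} → S⊆U {x}) ¬∃
      ... | inj₂ nU⊆S = nU⊆S ∘ ⊆-next U
    ... | yes (U , U∈𝒰 , S⊆U) with tower-extreme (t U∈𝒰) tS S⊆U
    ...   | inj₁ nS⊆U = inj₁ (⋃-upper {𝒰 = 𝒰} U∈𝒰 ∘ nS⊆U)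
    -- Now `S` equals the extreme set `U`, so comparing `U` with the whole union settles the claim.
    ...   | inj₂ U⊆S with refl ← ⊆-antisym S U S⊆U U⊆S
            with extreme-comparable (tower-extreme (t U∈𝒰)) (union 𝒰 t)
    ...     | inj₁ ⋃⊆U  = inj₂ ⋃⊆U
    ...     | inj₂ nU⊆⋃ = inj₁ nU⊆⋃

    tower-chain : ∀ {S C} → Tower S → Tower C → S ⊆ C ⊎ C ⊆ S
    tower-chain {C = C} tS tC with extreme-comparable (tower-extreme tC) tS
    ... | inj₁ S⊆C  = inj₁ S⊆C
    ... | inj₂ nC⊆S = inj₂ (nC⊆S ∘ ⊆-next C)

    top : Subset X
    top = ⋃ (decide ∘ Tower)

    top-tower : Tower top
    top-tower = union (decide ∘ Tower) decide⁻

    next-top⊆top : next top ⊆ top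
    next-top⊆top = ⋃-upper {𝒰 = decide ∘ Tower} (decide⁺ (step top-tower))

  -- Maximal sets for properties of finite character (Teichmüller-Tukey).

  module TeichmüllerTukey {X : Set a} (Ok : List X → Set b) (ok-[] : Ok [])
    (ok-⊆ : ∀ {xs ys} → xs ⊆ˡ ys → Ok ys → Ok xs) where

    Good : Subset X → Set (a ⊔ b)
    Good S = ∀ xs → All (_∈ˢ S) xs → Ok xs

    Extension : Subset X → X → Set (a ⊔ b)
    Extension S x = ¬ (x ∈ˢ S) × Good (insert x S)

    -- Excluded middle for a Σ-type comes with a witness, so `em` acts here as the choice function
    -- that selects the new element.
    extend : ∀ S → Dec (∃ (Extension S)) → Subset X
    extend S (yes (x , _)) = insert x S
    extend S (no _)        = S

    ⊆-extend : ∀ S (d : Dec (∃ (Extension S))) → S ⊆ extend S d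
    ⊆-extend S (yes _) x∈S = decide⁺ (inj₂ x∈S)
    ⊆-extend S (no _)  x∈S = x∈S

    extend-good : ∀ S (d : Dec (∃ (Extension S))) → Good S → Good (extend S d)
    extend-good S (yes (_ , _ , good)) _ = good
    extend-good S (no _)               g = g

    extend-closed : ∀ S (d : Dec (∃ (Extension S))) → extend S d ⊆ S → ¬ ∃ (Extension S)
    extend-closed S (yes (x , x∉S , _)) closed = contradiction (closed (decide⁺ (inj₁ refl))) x∉S
    extend-closed S (no ¬∃)             _      = ¬∃

    open BourbakiWitt (λ S → extend S em) (λ S → ⊆-extend S em)

    -- The tower is a chain, so the larger of two members of `𝒰` absorbs the elements found so far.
    -- The empty list is separate because `𝒰` may be empty.
    finite-union : ∀ 𝒰 → (∀ {S} → S ∈ˢ 𝒰 → Tower S) → ∀ xs → All (_∈ˢ ⋃ 𝒰) xs →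
      xs ≡ [] ⊎ (∃[ S ] S ∈ˢ 𝒰 × All (_∈ˢ S) xs)
    finite-union 𝒰 t []       []           = inj₁ refl
    finite-union 𝒰 t (x ∷ xs) (x∈⋃ ∷ xs∈⋃)
      with S , S∈𝒰 , x∈S ← decide⁻ x∈⋃ | finite-union 𝒰 t xs xs∈⋃
    ... | inj₁ refl = inj₂ (S , S∈𝒰 , x∈S ∷ [])
    ... | inj₂ (S′ , S′∈𝒰 , xs∈S′) with tower-chain (t S∈𝒰) (t S′∈𝒰)
    ...   | inj₁ S⊆S′ = inj₂ (S′ , S′∈𝒰 , S⊆S′ x∈S ∷ xs∈S′)
    ...   | inj₂ S′⊆S = inj₂ (S , S∈𝒰 , x∈S ∷ All.map (λ {z} → S′⊆S {z}) xs∈S′)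

    tower-good : ∀ {S} → Tower S → Good S
    tower-good (step {S} tS) = extend-good S em (tower-good tS)
    tower-good (union 𝒰 t)   xs xs∈⋃ with finite-union 𝒰 t xs xs∈⋃
    ... | inj₁ refl              = ok-[]
    ... | inj₂ (S , S∈𝒰 , xs∈S) = tower-good (t S∈𝒰) xs xs∈S

    split-insert : ∀ (x : X) S ys → All (_∈ˢ insert x S) ys → ∃[ xs ] All (_∈ˢ S) xs × ys ⊆ˡ x ∷ xs
    split-insert x S []       []       = [] , [] , λ ()
    split-insert x S (y ∷ ys) (p ∷ ps) with decide⁻ p | split-insert x S ys ps
    ... | inj₁ refl | xs , xs∈S , ys⊆ =
      xs , xs∈S , λ { (here refl) → here refl ; (there q) → ys⊆ q }
    ... | inj₂ y∈S  | xs , xs∈S , ys⊆ =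
      y ∷ xs , y∈S ∷ xs∈S ,
      λ { (here refl) → there (here refl) ; (there q) → weaken (ys⊆ q) }
      where
      weaken : ∀ {z} → z ∈ˡ x ∷ xs → z ∈ˡ x ∷ y ∷ xs
      weaken = ∷⁺ʳ x (xs⊆x∷xs xs y)

    -- `top` is fixed by `extend`, so it has no good one-element extension. By `split-insert`, a
    -- finite subset of `insert x top` lies in some `x ∷ xs` with `xs` from `top`, so only such
    -- lists need testing.
    maximal : ∃[ M ] Good M × (∀ x → (∀ xs → All (_∈ˢ M) xs → Ok (x ∷ xs)) → x ∈ˢ M)
    maximal = top , tower-good top-tower , λ x ok → byContradiction λ x∉M →
      extend-closed top em next-top⊆top (x , x∉M , λ ys ys∈ →
        let xs , xs∈M , ys⊆ = split-insert x top ys ys∈ in ok-⊆ ys⊆ (ok xs xs∈M))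

  module Compactness {T : Set a} {K : Set b} (Q : K → (T → Bool) → Set c)
    (support   : K → List T)
    (local     : ∀ k {F F′} → All (λ t → F t ≡ F′ t) (support k) → Q k F → Q k F′)
    (directed  : ∀ k k′ → ∃[ k″ ] ∀ F → Q k″ F → Q k F × Q k′ F)
    (satisfied : ∀ k → ∃ (Q k)) where

    Matches : (T → Bool) → T × Bool → Set
    Matches F (t , v) = F t ≡ v

    -- A finite list of prescribed values is acceptable if it extends to a solution for each `k`
    -- separately; the solution may depend on `k`.
    Ok : List (T × Bool) → Set _
    Ok xs = ∀ k → ∃[ F ] Q k F × All (Matches F) xs

    ok-[] : Ok []
    ok-[] k = let F , q = satisfied k in F , q , []

    ok-⊆ : ∀ {xs ys} → xs ⊆ˡ ys → Ok ys → Ok xs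
    ok-⊆ xs⊆ys ok k = let F , q , ps = ok k in F , q , All-resp-⊇ xs⊆ys ps

    open TeichmüllerTukey Ok ok-[] ok-⊆

    -- If some k refutes the value true at t and some k′ refutes false, then a k″ above
    -- both refutes M itself.
    decided : ∀ {M} → Good M → (∀ x → (∀ xs → All (_∈ˢ M) xs → Ok (x ∷ xs)) → x ∈ˢ M) →
      ∀ t → ¬ ((t , true) ∈ˢ M) → (t , false) ∈ˢ M
    decided good max t t∉M = byContradiction λ f∉M →
      let xs , ¬xs = ¬∀⇒∃¬ (t∉M ∘ max (t , true))
          ys , ¬ys = ¬∀⇒∃¬ (f∉M ∘ max (t , false))
          xs∈M , ¬okˣ = counterexample ¬xs
          ys∈M , ¬okʸ = counterexample ¬ys
          k , ¬k = ¬∀⇒∃¬ ¬okˣ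
          k′ , ¬k′ = ¬∀⇒∃¬ ¬okʸ
          k″ , both = directed k k′
          F , q , ps = good (xs ++ ys) (Allₚ.++⁺ xs∈M ys∈M) k″
          q₁ , q₂ = both F q
          ps₁ , ps₂ = Allₚ.++⁻ xs ps
      in refute (F t) refl (λ Ft → ¬k (F , q₁ , Ft ∷ ps₁)) (λ Ft → ¬k′ (F , q₂ , Ft ∷ ps₂))
      where
      counterexample : ∀ {p q} {P : Set p} {R : Set q} → ¬ (P → R) → P × ¬ R
      counterexample ¬imp = byContradiction (λ ¬p → ¬imp λ p → contradiction p ¬p) , λ r → ¬imp λ _ → r
      refute : ∀ {p} {P : Set p} v {w} → w ≡ v → ¬ (w ≡ true) → ¬ (w ≡ false) → P
      refute true  w≡v ¬t _  = contradiction w≡v ¬t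
      refute false w≡v _  ¬f = contradiction w≡v ¬f

    compactness : ∃[ F ] ∀ k → Q k F
    compactness with M , good , max ← maximal = F , λ k →
      -- The restriction of `F` to `support k` is a finite part of `M`, so it extends to a solution
      -- `F′` for `k`; `local` then replaces `F′` by `F`.
      let F′ , q , ps = good (map graph (support k)) (graph-in (support k)) k
      in local k (Allₚ.map⁻ ps) q
      where
      F : T → Bool
      F t = M (t , true)
      graph : T → T × Bool
      graph t = t , F t
      graph∈M : ∀ t v → F t ≡ v → (t , v) ∈ˢ M
      graph∈M t true  eq = eq
      graph∈M t false eq = decided good max t λ eq′ → contradiction (trans (sym eq′) eq) λ ()
      graph-in : ∀ ts → All (_∈ˢ M) (map graph ts)
      graph-in []       = []
      graph-in (t ∷ ts) = graph∈M t (F t) refl ∷ graph-in ts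

-- Structures and quantifier-free types

open Equivalence using (to; from)
open Structure using (Carrier; setoid)

private
  variable
    ℓ κ : Level
    L : Language ℓ
    A B M M′ : Structure L

idᴱ : Embedding A A
idᴱ {A = A} = record
  { injection = record { to = id ; cong = id ; injective = id }
  ; fun-homo  = λ f xs → Setoid.refl (setoid A)
  ; rel-iff   = λ R xs → ⇔-id _
  }

inclusion : (S : Substructure B) → Embedding (induced S) B
inclusion {B = B} S = record
  { injection = record { to = proj₁ ; cong = id ; injective = id }
  ; fun-homo  = λ f xs → Setoid.refl (setoid B)
  ; rel-iff   = λ R xs → ⇔-id _
  }

idᴵ : Isomorphism A A
idᴵ {A = A} = record { embedding = idᴱ ; surjective = λ x → x , id }

module _ (i : Embedding A B) where
  private
    module A = Structure A
    module B = Structure B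
    module SA = Setoid A.setoid
    module SB = Setoid B.setoid
    module i = Embedding i

  image : Substructure B
  image = record
    { member     = λ y → ∃[ x ] i.to x B.≈ y
    ; resp       = λ { y≈z (x , p) → x , SB.trans p y≈z }
    ; fun-closed = λ f ys ps → A.fun f (proj₁ ∘ ps) ,
        SB.trans (i.fun-homo f (proj₁ ∘ ps)) (B.fun-cong f (proj₂ ∘ ps))
    }

  corestrict : Embedding A (induced image)
  corestrict = record
    { injection = record
        { to = λ x → i.to x , x , SB.refl ; cong = i.cong ; injective = i.injective }
    ; fun-homo  = i.fun-homo
    ; rel-iff   = i.rel-iff
    }

  retract : Embedding (induced image) A
  retract = record
    { injection = record
        { to        = λ (_ , x , _) → x
        ; cong      = λ { {_ , _ , p} {_ , _ , q} y≈z →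
                        i.injective (SB.trans p (SB.trans y≈z (SB.sym q))) }
        ; injective = λ { {_ , _ , p} {_ , _ , q} x≈w →
                        SB.trans (SB.sym p) (SB.trans (i.cong x≈w) q) }
        }
    ; fun-homo  = λ f xs → SA.refl
    ; rel-iff   = λ R xs →
        mk⇔ (from (i.rel-iff R _) ∘ B.rel-resp R (λ k → SB.sym (proj₂ (proj₂ (xs k)))))
            (B.rel-resp R (λ k → proj₂ (proj₂ (xs k))) ∘ to (i.rel-iff R _))
    }

module _ (e : Embedding A B) {n} {ρ : Vector (Carrier A) n} {ρ′ : Vector (Carrier B) n}
  (e∘ρ≈ρ′ : ∀ k → Structure._≈_ B (Embedding.to e (ρ k)) (ρ′ k)) where
  private
    module SA = Semantics A
    module SB = Semantics B
    module B = Structure B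
    module Eq = Setoid B.setoid
    module e = Embedding e

  term-homo : ∀ t → e.to (SA.⟦ t ⟧ᵗ ρ) B.≈ SB.⟦ t ⟧ᵗ ρ′
  term-homo (var k)    = e∘ρ≈ρ′ k
  term-homo (app f ts) = Eq.trans (e.fun-homo f _) (B.fun-cong f λ k → term-homo (ts k))

  atomic-iff : ∀ α → SA.⟦ α ⟧ᵃ ρ ⇔ SB.⟦ α ⟧ᵃ ρ′
  atomic-iff (s ≈′ t) = mk⇔
    (λ p → Eq.trans (Eq.sym (term-homo s)) (Eq.trans (e.cong p) (term-homo t)))
    (λ q → e.injective (Eq.trans (term-homo s) (Eq.trans q (Eq.sym (term-homo t)))))
  atomic-iff (rel′ R ts) = mk⇔
    (B.rel-resp R (λ k → term-homo (ts k)) ∘ to (e.rel-iff R _))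
    (from (e.rel-iff R _) ∘ B.rel-resp R (λ k → Eq.sym (term-homo (ts k))))

-- A tuple realising the quantifier-free type of ρ is the image of ρ under an
-- embedding of the structure generated by ρ.
module _ {L : Language ℓ} {M M′ : Structure L} {n}
  {ρ : Vector (Carrier M) n} {ρ′ : Vector (Carrier M′) n} where
  private
    module M = Structure M
    module M′ = Structure M′
    module Eq = Setoid M.setoid
    module Eq′ = Setoid M′.setoid
    module S = Semantics M
    module S′ = Semantics M′

  term : ∀ {z} → Generated M ρ z → Term L n
  term (gen k)      = var k
  term (app f _ ps) = app f (λ k → term (ps k))
  term (resp _ p)   = term p

  eval-term : ∀ {z} (p : Generated M ρ z) → S.⟦ term p ⟧ᵗ ρ M.≈ z
  eval-term (gen k)      = Eq.refl
  eval-term (app f _ ps) = M.fun-cong f λ k → eval-term (ps k)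
  eval-term (resp z≈w p) = Eq.trans (eval-term p) z≈w

  transfer : (∀ α → S.⟦ α ⟧ᵃ ρ ⇔ S′.⟦ α ⟧ᵃ ρ′) → Embedding (induced (⟨_⟩ {B = M} ρ)) M′
  transfer same = record
    { injection = record
        { to        = λ (_ , p) → S′.⟦ term p ⟧ᵗ ρ′
        ; cong      = λ { {_ , p} {_ , q} z≈w → to (same (term p ≈′ term q))
                        (Eq.trans (eval-term p) (Eq.trans z≈w (Eq.sym (eval-term q)))) }
        ; injective = λ { {_ , p} {_ , q} eq → Eq.trans (Eq.sym (eval-term p))
                        (Eq.trans (from (same (term p ≈′ term q)) eq) (eval-term q)) }
        }
    ; fun-homo  = λ f xs → Eq′.refl
    ; rel-iff   = λ R xs → let ts = λ k → term (proj₂ (xs k)) in mk⇔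
        (to (same (rel′ R ts)) ∘ M.rel-resp R (λ k → Eq.sym (eval-term (proj₂ (xs k)))))
        (M.rel-resp R (λ k → eval-term (proj₂ (xs k))) ∘ from (same (rel′ R ts)))
    }

generatedBy₂ : (B : Structure L) (xy : Carrier B × Carrier B) → Substructure B
generatedBy₂ B (x , y) = ⟨_⟩ {B = B} (x ∷ᵛ y ∷ᵛ []ᵛ)

pull-order : (e : Embedding A B) {a b : Level} {R : Rel (Carrier A) a} {R′ : Rel (Carrier B) b} →
  (∀ x y → R x y ⇔ R′ (Embedding.to e x) (Embedding.to e y)) →
  IsTotalOrder (Structure._≈_ B) R′ → IsTotalOrder (Structure._≈_ A) R
pull-order e R⇔R′ = OrderMonomorphism.isTotalOrder record
  { isOrderHomomorphism = record { cong = e.cong ; mono = to (R⇔R′ _ _) }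
  ; injective           = e.injective
  ; cancel              = from (R⇔R′ _ _)
  }
  where
  module e = Embedding e

-- By `transfer`, embeddings of the substructure generated by `xy` into `D` correspond to the pairs
-- of `D` with the quantifier-free type of `xy`. Monochromaticity is thus a statement about all
-- pairs of one type.
Homogeneous : (B {D C} : Structure L) (χ : Carrier C → Carrier C → Bool) → Embedding D C →
  Carrier B × Carrier B → Set _
Homogeneous B {D} χ e xy = ∀ (f g : Embedding (induced (generatedBy₂ B xy)) D) → colour f ≡ colour g
  where
  colour : Embedding (induced (generatedBy₂ B xy)) D → Bool
  colour f = χ (e∘f.to (_ , gen zero)) (e∘f.to (_ , gen (suc zero)))
    where
    module e∘f = Embedding (e ∘ᴱ f)

Congruent₂ : (C : Structure L) → (Carrier C → Carrier C → Bool) → Set _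
Congruent₂ C χ = ∀ {x x′ y y′} → x ≈ x′ → y ≈ y′ → χ x y ≡ χ x′ y′
  where
  open Structure C

module Enumeration (A : Structure L) (finite-A : IsFinite A) where
  open Structure A using (_≈_)
  private
    module index = Inverse (proj₂ finite-A)

  points : List (Carrier A)
  points = map index.to (allFin _)

  pairs : List (Carrier A × Carrier A)
  pairs = cartesianProduct points points

  pairs-cover : ∀ x y → ∃[ u ] ∃[ v ] (u , v) ∈ˡ pairs × u ≈ x × v ≈ y
  pairs-cover x y = _ , _ , ∈-cartesianProduct⁺ (point x) (point y) ,
    index.strictlyInverseˡ x , index.strictlyInverseˡ y
    where
    point : ∀ x → index.to (index.from x) ∈ˡ points
    point x = ∈-map⁺ index.to (∈-allFin (index.from x))

  index-≤ : Carrier A → Carrier A → Bool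
  index-≤ x y = does (index.from x ≤? index.from y)

  index-≤-cong : Congruent₂ A index-≤
  index-≤-cong p q = cong₂ (λ k l → does (k ≤? l)) (index.from-cong p) (index.from-cong q)

  index-≤-order : IsTotalOrder _≈_ (λ x y → index-≤ x y ≡ true)
  index-≤-order = OrderMonomorphism.isTotalOrder record
    { isOrderHomomorphism = record
        { cong = index.from-cong
        ; mono = λ {x} {y} → does⁻ (index.from x ≤? index.from y)
        }
    ; injective           = λ {x} {y} eq → Setoid.trans (setoid A)
        (Setoid.sym (setoid A) (index.strictlyInverseˡ x))
        (Setoid.trans (setoid A) (index.to-cong eq) (index.strictlyInverseˡ y))
    ; cancel              = λ {x} {y} → dec-true (index.from x ≤? index.from y)
    } ≤-isTotalOrder

-- The Ramsey property

module _ {L : Language ℓ} {𝒞 : Pred (Structure L) κ} (ramsey : IsRamseyClass 𝒞) where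
  open IsRamseyClass ramsey

  -- `ERP` speaks of substructures, so `A` is replaced by its image in `B`: colourings are moved
  -- along `corestrict i`, embeddings of `A` along `retract i`.
  erp-embedding : B ∈ 𝒞 → Embedding A B → ∃[ C ] C ∈ 𝒞 × (C ⟶⟨ B ⟩^ A)
  erp-embedding {B = B} {A = A} B∈𝒞 i
    with C , C∈𝒞 , arrow ← erp B∈𝒞 (image i) (hp B∈𝒞 (image i)) = C , C∈𝒞 , arrow′
    where
    arrow′ : C ⟶⟨ B ⟩^ A
    arrow′ χ =
      let e , const = arrow record
            { to   = λ f → Func.to χ (f ∘ᴱ corestrict i)
            ; cong = λ f≈g → Func.cong χ λ x → f≈g (Embedding.to (corestrict i) x)
            }
          unfold = λ f → Func.cong χ {e ∘ᴱ f} {(e ∘ᴱ (f ∘ᴱ retract i)) ∘ᴱ corestrict i}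
                         λ _ → Setoid.refl (setoid C)
      in e , λ f g → trans (unfold f)
           (trans (const (f ∘ᴱ retract i) (g ∘ᴱ retract i)) (sym (unfold g)))

  -- Induction on the list: `e₁ : D → C` makes `χ` constant on copies of the first pair, and the
  -- induction hypothesis treats the remaining pairs for `χ` pulled back to `D`. Composing with `e`
  -- keeps the first pair homogeneous, since `e ∘ᴱ f` is again an embedding into `D`. The component
  -- `Embedding B C` lets the next pair be regarded as lying in the structure reached.
  homogeneous-embedding : {B : Structure L} → B ∈ 𝒞 → ∀ (xys : List (Carrier B × Carrier B)) →
    ∃[ C ] C ∈ 𝒞 × Embedding B C ×
    (∀ χ → Congruent₂ C χ → Σ[ e ∈ Embedding B C ] All (Homogeneous B χ e) xys)
  homogeneous-embedding {B} B∈𝒞 [] = B , B∈𝒞 , idᴱ , λ _ _ → idᴱ , []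
  homogeneous-embedding {B} B∈𝒞 (xy ∷ xys)
    with D , D∈𝒞 , j , homD ← homogeneous-embedding B∈𝒞 xys
    with C , C∈𝒞 , arrow ← erp-embedding D∈𝒞 (j ∘ᴱ inclusion (generatedBy₂ B xy))
    -- The arrow yields an embedding of `D` only in answer to a colouring; a constant one serves.
    = C , C∈𝒞 , proj₁ (monochromatic (λ _ _ → true) λ _ _ → refl) ∘ᴱ j , λ χ χ-cong →
      let e₁ , hom₁ = monochromatic χ χ-cong
          module e₁ = Embedding e₁
          e , hom = homD (λ x y → χ (e₁.to x) (e₁.to y)) (λ p q → χ-cong (e₁.cong p) (e₁.cong q))
      in e₁ ∘ᴱ e , (λ f g → hom₁ (e ∘ᴱ f) (e ∘ᴱ g)) ∷ hom
    where
    monochromatic : ∀ χ → Congruent₂ C χ → Σ[ e ∈ Embedding D C ] Homogeneous B χ e xy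
    monochromatic χ χ-cong =
      let e , const = arrow record
            { to   = λ f → Inverse.from 2↔Bool
                (χ (Embedding.to f (_ , gen zero)) (Embedding.to f (_ , gen (suc zero))))
            ; cong = λ f≈g → cong (Inverse.from 2↔Bool) (χ-cong (f≈g _) (f≈g _))
            }
      in e , λ f g → trans (sym (Inverse.strictlyInverseˡ 2↔Bool _))
           (trans (cong (Inverse.to 2↔Bool) (const f g)) (Inverse.strictlyInverseˡ 2↔Bool _))

-- Relations decided by sets of quantifier-free types.

module _ (em : ∀ {a} → ExcludedMiddle a) (ext : ∀ {a b} → Extensionality a b) where
  open Classical em ext

  -- A type is encoded by the truth values of its atomic formulas. Unlike `CompleteQFType` this
  -- stays at level `ℓ`, so it can index an `InfDNF`, and realising the same type becomes an
  -- equation.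
  QFType : Language ℓ → Set ℓ
  QFType L = Atomic L 2 → Bool

  qftp : (M : Structure L) → Carrier M → Carrier M → QFType L
  qftp M x y α = decide (Semantics.⟦_⟧ᵃ M α (x ∷ᵛ y ∷ᵛ []ᵛ))

  qftp-embedding : (e : Embedding A B) → ∀ {x y x′ y′} →
    Structure._≈_ B (Embedding.to e x) x′ → Structure._≈_ B (Embedding.to e y) y′ →
    qftp A x y ≡ qftp B x′ y′
  qftp-embedding e x≈x′ y≈y′ = ext λ α →
    does-⇔ (atomic-iff e (λ { zero → x≈x′ ; (suc zero) → y≈y′ }) α) em em

  qftp-iff : ∀ {x y x′ y′} → qftp M x y ≡ qftp M′ x′ y′ → ∀ α →
    Semantics.⟦_⟧ᵃ M α (x ∷ᵛ y ∷ᵛ []ᵛ) ⇔ Semantics.⟦_⟧ᵃ M′ α (x′ ∷ᵛ y′ ∷ᵛ []ᵛ)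
  qftp-iff tp≡ α = mk⇔ (λ p → decide⁻ (trans (sym (cong (λ t → t α) tp≡)) (decide⁺ p)))
                       (λ p → decide⁻ (trans (cong (λ t → t α) tp≡) (decide⁺ p)))

  literal : Bool → Atomic L 2 → Literal L 2
  literal v α = if v then pos α else neg α

  disjunction : (QFType L → Bool) → InfDNF L 2
  disjunction {L = L} F = record
    { I = ∃[ t ] F t ≡ true
    ; J = λ _ → Atomic L 2
    ; φ = λ (t , _) α → literal (t α) α
    }

  realises : ∀ (M : Structure L) {x y} t →
    (∀ α → Semantics.⟦_⟧ˡ M (literal (t α) α) (x ∷ᵛ y ∷ᵛ []ᵛ)) ⇔ (t ≡ qftp M x y)
  realises M {x} {y} t = mk⇔ (λ sat → ext λ α → ⇒ (t α) α (sat α)) λ { refl α → ⇐ α }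
    where
    open Semantics M
    ρ = x ∷ᵛ y ∷ᵛ []ᵛ
    ⇒ : ∀ v α → ⟦ literal v α ⟧ˡ ρ → v ≡ decide (⟦ α ⟧ᵃ ρ)
    ⇒ true  α p  = sym (decide⁺ p)
    ⇒ false α ¬p = sym (dec-false em ¬p)
    ⇐ : ∀ α → ⟦ literal (decide (⟦ α ⟧ᵃ ρ)) α ⟧ˡ ρ
    ⇐ α with em {P = ⟦ α ⟧ᵃ ρ}
    ... | yes p = p
    ... | no ¬p = ¬p

  -- A pair realises exactly one `t`, namely its own `qftp`, so only that disjunct can hold.
  defined-iff : ∀ (M : Structure L) F x y → definedRel M (disjunction F) x y ⇔ (F (qftp M x y) ≡ true)
  defined-iff M F x y = mk⇔
    (λ { ((t , Ft) , sat) → subst (λ t → F t ≡ true) (to (realises M t) sat) Ft })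
    (λ Ft → (_ , Ft) , from (realises M _) refl)

  Orders : (A : Structure L) → (QFType L → Bool) → Set _
  Orders A F = IsLinearOrder A (definedRel A (disjunction F))

  defined-embedding : (e : Embedding A B) → ∀ F x y →
    definedRel A (disjunction F) x y ⇔
    definedRel B (disjunction F) (Embedding.to e x) (Embedding.to e y)
  defined-embedding {A = A} {B = B} e F x y = mk⇔
    (from (defined-iff B F _ _) ∘ trans (cong F (sym same)) ∘ to (defined-iff A F x y))
    (from (defined-iff A F x y) ∘ trans (cong F same) ∘ to (defined-iff B F _ _))
    where
    same = qftp-embedding e (Setoid.refl (setoid B)) (Setoid.refl (setoid B))

  -- One set of types that orders every member of the class.

  module _ {L : Language ℓ} {𝒞 : Pred (Structure L) κ} (ramsey : IsRamseyClass 𝒞) where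
    open IsRamseyClass ramsey

    -- The list contains `(x , y)` up to `≈` as some `(u , v)`. Both given pairs have the type of
    -- `(u , v)`, so `transfer` makes them images of that pair under two embeddings into `B`, to
    -- which homogeneity applies.
    homogeneous-qftp : {B C : Structure L} (finite-B : IsFinite B) (χ : Carrier C → Carrier C → Bool)
      (e : Embedding B C) → All (Homogeneous B χ e) (Enumeration.pairs B finite-B) →
      ∀ {x y x′ y′} → qftp B x y ≡ qftp B x′ y′ →
      χ (Embedding.to e x) (Embedding.to e y) ≡ χ (Embedding.to e x′) (Embedding.to e y′)
    homogeneous-qftp {B} finite-B χ e hom {x} {y} tp≡
      with u , v , uv∈ , u≈x , v≈y ← Enumeration.pairs-cover B finite-B x y =
      All.lookup hom uv∈ (transfer (qftp-iff tp-uv)) (transfer (qftp-iff (trans tp-uv tp≡)))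
      where
      tp-uv : qftp B u v ≡ qftp B x y
      tp-uv = qftp-embedding (idᴱ {A = B}) u≈x v≈y

    order-on-member : {B : Structure L} → B ∈ 𝒞 → ∃ (Orders B)
    order-on-member {B} B∈𝒞
      with C , C∈𝒞 , _ , hom ← homogeneous-embedding ramsey B∈𝒞 (Enumeration.pairs B (finite B∈𝒞))
      with e , hom-e ← hom (Enumeration.index-≤ C (finite C∈𝒞)) (Enumeration.index-≤-cong C (finite C∈𝒞))
      = F , pull-order e defined⇔≤ index-≤-order
      where
      open Enumeration C (finite C∈𝒞)
      module e = Embedding e
      -- One increasing pair of type `t` suffices, since by homogeneity all pairs of `B` of that
      -- type then increase. `F` is false at types not realised in `B`.
      Increasing : QFType L → Set _
      Increasing t = ∃[ x ] ∃[ y ] qftp B x y ≡ t × index-≤ (e.to x) (e.to y) ≡ true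
      F : QFType L → Bool
      F t = decide (Increasing t)
      F⇔≤ : ∀ x y → F (qftp B x y) ≡ true ⇔ index-≤ (e.to x) (e.to y) ≡ true
      F⇔≤ x y = mk⇔
        (λ Ft → let x′ , y′ , tp≡ , x′≤y′ = decide⁻ {P = Increasing _} Ft in
          trans (sym (homogeneous-qftp (finite B∈𝒞) index-≤ e hom-e tp≡)) x′≤y′)
        (λ x≤y → decide⁺ (x , y , refl , x≤y))
      defined⇔≤ : ∀ x y → definedRel B (disjunction F) x y ⇔ (index-≤ (e.to x) (e.to y) ≡ true)
      defined⇔≤ x y = mk⇔ (to (F⇔≤ x y) ∘ to (defined-iff B F x y))
                          (from (defined-iff B F x y) ∘ from (F⇔≤ x y))

    member-qftps : {A : Structure L} → A ∈ 𝒞 → List (QFType L)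
    member-qftps {A} A∈𝒞 = map (λ (x , y) → qftp A x y) (Enumeration.pairs A (finite A∈𝒞))

    -- Every pair of `A` is `≈` to a listed one, so `F` and `F′` agree on all types realised in `A`
    -- and define the same relation there.
    orders-local : {A : Structure L} (A∈𝒞 : A ∈ 𝒞) → ∀ {F F′} →
      All (λ t → F t ≡ F′ t) (member-qftps A∈𝒞) → Orders A F → Orders A F′
    orders-local {A} A∈𝒞 {F} {F′} agree = pull-order (idᴱ {A = A}) λ x y → mk⇔
      (from (defined-iff A F x y) ∘ trans (same x y) ∘ to (defined-iff A F′ x y))
      (from (defined-iff A F′ x y) ∘ trans (sym (same x y)) ∘ to (defined-iff A F x y))
      where
      same : ∀ x y → F (qftp A x y) ≡ F′ (qftp A x y)
      same x y
        with u , v , uv∈ , u≈x , v≈y ← Enumeration.pairs-cover A (finite A∈𝒞) x y =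
        subst (λ t → F t ≡ F′ t) (qftp-embedding (idᴱ {A = A}) u≈x v≈y)
          (All.lookup (Allₚ.map⁻ agree) uv∈)

    order-on-class : ∃[ F ] ∀ A → A ∈ 𝒞 → Orders A F
    order-on-class = let F , orders = compactness in F , λ A A∈𝒞 → orders (A , A∈𝒞)
      where
      Q : ∃ (_∈ 𝒞) → (QFType L → Bool) → Set _
      Q (A , _) = Orders A
      support : ∃ (_∈ 𝒞) → List (QFType L)
      support (_ , A∈𝒞) = member-qftps A∈𝒞
      local : ∀ k {F F′} → All (λ t → F t ≡ F′ t) (support k) → Q k F → Q k F′
      local (_ , A∈𝒞) = orders-local A∈𝒞
      directed : ∀ k k′ → ∃[ k″ ] ∀ F → Q k″ F → Q k F × Q k′ F
      -- An order defined on a joint extension restricts to both members, since embeddings preserve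
      -- and reflect the defined relation.
      directed (_ , A∈𝒞) (_ , B∈𝒞) =
        let C , C∈𝒞 , e , e′ = jep A∈𝒞 B∈𝒞
        in (C , C∈𝒞) , λ F orders →
             pull-order e (defined-embedding e F) orders ,
             pull-order e′ (defined-embedding e′ F) orders
      satisfied : ∀ k → ∃ (Q k)
      satisfied (_ , A∈𝒞) = order-on-member A∈𝒞
      open Compactness Q support local directed satisfied

  -- `N` may be infinite and so lie outside the class. Each order axiom involves at most three
  -- points, and the substructure they generate belongs to `Age N` and inherits the defined
  -- relation.
  order-from-age : (N : Structure L) → ∀ F → (∀ A → Age N A → Orders A F) → Orders N F
  order-from-age N F orders = record
    { isPartialOrder = record
      { isPreorder = record
        { isEquivalence = N.isEquivalence
        -- Axioms about two points repeat `y` as the third generator.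
        ; reflexive     = λ {x} {y} → Triple.reflexive x y y
        ; trans         = λ {x} {y} {z} → Triple.transitive x y z
        }
      ; antisym    = λ {x} {y} → Triple.antisymmetric x y y
      }
    ; total          = λ x y → Triple.total x y y
    }
    where
    module N = Setoid (setoid N)
    _≲_ : Rel (Carrier N) _
    _≲_ = definedRel N (disjunction F)
    module Triple (x y z : Carrier N) where
      sub : Substructure N
      sub = ⟨_⟩ {B = N} (x ∷ᵛ y ∷ᵛ z ∷ᵛ []ᵛ)
      x̂ ŷ ẑ : Carrier (induced sub)
      x̂ = x , gen zero
      ŷ = y , gen (suc zero)
      ẑ = z , gen (suc (suc zero))
      module O = IsTotalOrder (orders (induced sub) (3 , _ , idᴵ))
      into : ∀ u v → proj₁ u ≲ proj₁ v → definedRel (induced sub) (disjunction F) u v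
      into u v = from (defined-embedding (inclusion sub) F u v)
      out : ∀ u v → definedRel (induced sub) (disjunction F) u v → proj₁ u ≲ proj₁ v
      out u v = to (defined-embedding (inclusion sub) F u v)
      reflexive : x N.≈ y → x ≲ y
      reflexive x≈y = out x̂ ŷ (O.reflexive {x̂} {ŷ} x≈y)
      transitive : x ≲ y → y ≲ z → x ≲ z
      transitive p q = out x̂ ẑ (O.trans {x̂} {ŷ} {ẑ} (into x̂ ŷ p) (into ŷ ẑ q))
      antisymmetric : x ≲ y → y ≲ x → x N.≈ y
      antisymmetric p q = O.antisym {x̂} {ŷ} (into x̂ ŷ p) (into ŷ x̂ q)
      total : x ≲ y ⊎ y ≲ x
      total = Sum.map (out x̂ ŷ) (out ŷ x̂) (O.total x̂ ŷ)

  completeType : (N : Structure L) → Carrier N → Carrier N → CompleteQFType L 2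
  completeType N x y = record
    { formulas    = λ φ → Semantics.⟦_⟧ N φ (x ∷ᵛ y ∷ᵛ []ᵛ)
    ; satisfiable = N , (x ∷ᵛ y ∷ᵛ []ᵛ) , λ _ → id
    ; complete    = λ φ → toSum em
    }

  -- The types are indexed by the increasing pairs of `N` rather than by the `t` accepted by `F`,
  -- since a pair witnesses that its type is satisfiable.
  defined-union : (N : Structure L) → ∀ F → IsUnionOfQFTypes N (definedRel N (disjunction F))
  defined-union N F =
    (∃[ x ] ∃[ y ] definedRel N (disjunction F) x y) , (λ (x , y , _) → completeType N x y) ,
    λ x y → mk⇔ (λ x≤y → (x , y , x≤y) , λ _ → id)
      λ { ((x′ , y′ , x′≤y′) , sat) → from (defined-iff N F x y)
            (trans (cong F (same sat)) (to (defined-iff N F x′ y′) x′≤y′)) }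
    where
    same : ∀ {x y x′ y′} → Satisfies N (CompleteQFType.formulas (completeType N x′ y′)) (x ∷ᵛ y ∷ᵛ []ᵛ) →
      qftp N x y ≡ qftp N x′ y′
    same sat = ext λ α → does-⇔
      -- `sat` only carries formulas from `(x′ , y′)` to `(x , y)`; the other direction comes from
      -- applying it to the negated atom.
      (mk⇔ (λ p → byContradiction λ ¬p → sat (¬′ atom α) ¬p p) (sat (atom α))) em em

theorem2 : (∀ {a} → ExcludedMiddle a) → (∀ {a b} → Extensionality a b) →
    ∀ {ℓ κ} (L : Language ℓ) (𝒞 : Pred (Structure L) κ) (N : Structure L) →
    IsRamseyClass 𝒞 → Age N ≐ 𝒞 →
    ∃ λ (_≤_ : Rel (Structure.Carrier N) ℓ) →
    IsLinearOrder N _≤_ × IsAutInvariant N _≤_ × IsUnionOfQFTypes N _≤_ ×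
    (Σ[ Φ ∈ InfDNF L 2 ]
    (∀ x y → (x ≤ y) ⇔ definedRel N Φ x y) ×
    (∀ A → A ∈ 𝒞 → IsLinearOrder A (definedRel A Φ)))
theorem2 em ext L 𝒞 N ramsey (age⊆𝒞 , _) =
  let F , orders = order-on-class em ext ramsey
      Φ = disjunction em ext F
  in definedRel N Φ ,
     order-from-age em ext N F (λ A A∈age → orders A (age⊆𝒞 A∈age)) ,
     (λ σ → defined-embedding em ext (Isomorphism.embedding σ) F) ,
     defined-union em ext N F ,
     Φ , (λ _ _ → ⇔-id _) , orders
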